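{- For non-preemptive machine minimization with agreeable deadlines, there is an online $16$-competitive algorithm.
   Context: Machine minimization with deadlines: each job $j$ of a finite instance has integer release date $r_j$, processing time $p_j$ and deadline $d_j$. A feasible non-preemptive schedule on a given number of identical machines processes each job uninterrupted on a single machine for $p_j$ consecutive time units within $[r_j,d_j]$, each machine processing at most one job at a time. $m$ is the minimum number of machines admitting such a schedule. Online: each job becomes known only at its release date, the algorithm makes irrevocable decisions (including opening machines) over time and does not know $m$. An algorithm is $c$-competitive if on every instance it produces a feasible schedule using at most $c\cdot m$ machines. Agreeable deadlines: for any jobs $j,k$ with $r_j<r_k$ we have $d_j\le d_k$. -}

module Defs where

open import Data.Nat using (ℕ; zero; suc; _+_; _*_; _≤_; _<_)
open import Data.List using (List; []; _∷_; length)
open import Data.Product using (Σ; _×_; _,_; proj₁; proj₂)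
open import Data.Sum using (_⊎_)
open import Relation.Binary.PropositionalEquality using (_≡_; _≢_)

-- A job as it becomes known at its release date: processing time and deadline.
-- (Its release date is the time of the batch it belongs to, see below.)
record Job : Set where
  constructor job
  field
    proc : ℕ
    dl   : ℕ

-- A finite instance, given as release batches: the t-th list is the list of
-- jobs with release date t.  Times beyond the end of the list have no jobs.
Instance : Set
Instance = List (List Job)

batch : Instance → ℕ → List Job
batch []      t       = []
batch (b ∷ I) zero    = b
batch (b ∷ I) (suc t) = batch I t

at : List Job → ℕ → Job
at []       k       = job 0 0
at (x ∷ xs) zero    = x
at (x ∷ xs) (suc k) = at xs k

-- A job is identified by (release date, position within its release batch).
JobId : Set
JobId = ℕ × ℕ

IsJob : Instance → JobId → Set
IsJob I (t , k) = k < length (batch I t)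

r : JobId → ℕ
r (t , k) = t

p : Instance → JobId → ℕ
p I (t , k) = Job.proc (at (batch I t) k)

d : Instance → JobId → ℕ
d I (t , k) = Job.dl (at (batch I t) k)

record Schedule : Set where
  constructor sched
  field
    start   : JobId → ℕ
    machine : JobId → ℕ
open Schedule public

FeasibleSchedule : Instance → ℕ → Schedule → Set
FeasibleSchedule I c σ =
  (∀ j → IsJob I j →
     r j ≤ start σ j × start σ j + p I j ≤ d I j × machine σ j < c)
  × (∀ j k → IsJob I j → IsJob I k → j ≢ k → machine σ j ≡ machine σ k →
       (start σ j + p I j ≤ start σ k) ⊎ (start σ k + p I k ≤ start σ j))

Feasible : Instance → ℕ → Set
Feasible I c = Σ Schedule λ σ → FeasibleSchedule I c σ

IsMinMachines : Instance → ℕ → Set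
IsMinMachines I m = Feasible I m × (∀ c → Feasible I c → m ≤ c)

PositiveProc : Instance → Set
PositiveProc I = ∀ j → IsJob I j → 1 ≤ p I j

Agreeable : Instance → Set
Agreeable I = ∀ j k → IsJob I j → IsJob I k → r j < r k → d I j ≤ d I k

AgreeableInstance : Instance → Set
AgreeableInstance I = PositiveProc I × Agreeable I

Algorithm : Set
Algorithm = Instance → Schedule

-- Online: all decisions taken by time t (which jobs are started by time t, and
-- their start times and machines) depend only on the jobs released by time t.
Online : Algorithm → Set
Online A =
  ∀ I I' → AgreeableInstance I → AgreeableInstance I' → ∀ t →
  (∀ s → s ≤ t → batch I s ≡ batch I' s) →
  ∀ j → IsJob I j → r j ≤ t →
  (start (A I) j ≤ t ⊎ start (A I') j ≤ t) →
  (start (A I) j ≡ start (A I') j) × (machine (A I) j ≡ machine (A I') j)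

Competitive : ℕ → Algorithm → Set
Competitive c A =
  ∀ I → AgreeableInstance I → ∀ m → IsMinMachines I m →
  FeasibleSchedule I (c * m) (A I)

{-# OPTIONS --safe #-}
module Submission where

-- Call a job loose if 4 p ≤ d − r and tight otherwise, and keep separate machines for the
-- two kinds.  A tight job starts at the middle r + ⌊ (d − r − p) /2⌋ of its start window;
-- a loose job starts as early as possible, but must start by r + ⌊ (d − r) /2⌋.  In order of
-- these ready times (ties by deadline) each job is appended to the first machine of its kind
-- that allows it to start in time.
--
-- If a loose job j with window length L is refused by K machines, these are busy for more
-- than L / 2 from r on.  All that work is loose, due by d, and was started in the first half
-- of its window, hence was released after r − 3 L.  A schedule on m machines fits it all into
-- a window of length 4 L, so K L / 2 < 4 L m.
--
-- If a tight job is refused by K machines, these are all busy at its start t.  Let q be the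
-- shortest processing time of the jobs running there.  By agreeability, each of these jobs
-- must, in any feasible schedule, end after about t − 5 q / 2 and start before about
-- t + 5 q / 2, hence has q units processed in a window of length 7 q around t: K q ≤ 7 q m.

open import Defs
open import Data.Product using (Σ; _×_)

open import Data.Bool using (Bool; true; false; if_then_else_)
open import Data.Fin as Fin using (Fin; toℕ; fromℕ<; combine; remQuot)
import Data.Fin.Properties as Fin
open import Data.List using (List; []; _∷_; _++_; length; map; filter; upTo)
open import Data.List.Membership.Propositional using (_∈_)
open import Data.List.Membership.Propositional.Properties
  using (∈-++⁺ˡ; ∈-++⁺ʳ; ∈-++⁻; ∈-map⁺; ∈-map⁻; ∈-filter⁺; ∈-filter⁻; ∈-upTo⁺; ∈-upTo⁻)
open import Data.List.Relation.Binary.Permutation.Propositional using (↭-sym; ↭⇒↭ₛ)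
open import Data.List.Relation.Binary.Permutation.Propositional.Properties using (∈-resp-↭)
import Data.List.Relation.Binary.Permutation.Setoid.Properties as ↭ₛ
open import Data.List.Relation.Unary.All as All using (All; []; _∷_)
open import Data.List.Relation.Unary.AllPairs as AllPairs using (AllPairs; []; _∷_)
import Data.List.Relation.Unary.AllPairs.Properties as AllPairs
open import Data.List.Relation.Unary.Any using (here; there)
open import Data.List.Relation.Unary.Linked.Properties using (Linked⇒AllPairs)
import Data.List.Sort as Sort
open import Data.Nat
open import Data.Nat.Properties
open import Data.Nat.Tactic.RingSolver using (solve-∀)
open import Data.Product using (∃; _,_; proj₁; proj₂; uncurry)
open import Data.Product.Properties using (≡-dec; ,-injective)
open import Data.Sum using (_⊎_; inj₁; inj₂)
open import Function using (_∘_; id)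
open import Relation.Binary.Construct.Flip.EqAndOrd as Flip using ()
open import Relation.Binary.Construct.On as On using ()
open import Relation.Binary.PropositionalEquality
open import Relation.Nullary using (¬_; Dec; yes; no; does; contradiction)
open import Relation.Unary using (Decidable)
open ≤-Reasoning hiding (start)

-- Bounded search, halving, and counting of processed units.

least : ∀ {P : ℕ → Set} → Decidable P → ℕ → ℕ
least P? zero = zero
least P? (suc n) with P? 0
... | yes _ = 0
... | no  _ = suc (least (P? ∘ suc) n)

least-holds : ∀ {P : ℕ → Set} (P? : Decidable P) n → P n → P (least P? n)
least-holds P? zero    pn = pn
least-holds P? (suc n) pn with P? 0
... | yes p0 = p0
... | no  _  = least-holds (P? ∘ suc) n pn

least-minimal : ∀ {P : ℕ → Set} (P? : Decidable P) n {k} → k < least P? n → ¬ P k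
least-minimal P? (suc n) {k} k< with P? 0
least-minimal P? (suc n) {zero}  k<       | no ¬p0 = ¬p0
least-minimal P? (suc n) {suc k} (s≤s k<) | no _   = least-minimal (P? ∘ suc) n k<

least-≤ : ∀ {P : ℕ → Set} (P? : Decidable P) n → least P? n ≤ n
least-≤ P? zero    = z≤n
least-≤ P? (suc n) with P? 0
... | yes _ = z≤n
... | no  _ = s≤s (least-≤ (P? ∘ suc) n)

argmin : ∀ {n} (f : Fin (suc n) → ℕ) → ∃ λ i → ∀ j → f i ≤ f j
argmin {zero}  f = Fin.zero , λ { Fin.zero → ≤-refl }
argmin {suc n} f with argmin (f ∘ Fin.suc)
... | i , fi≤ with f Fin.zero ≤? f (Fin.suc i)
...   | yes f0≤ = Fin.zero , λ { Fin.zero → ≤-refl ; (Fin.suc j) → ≤-trans f0≤ (fi≤ j) }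
...   | no  f0≰ = Fin.suc i , λ { Fin.zero → <⇒≤ (≰⇒> f0≰) ; (Fin.suc j) → fi≤ j }

does-true : ∀ {P : Set} (d : Dec P) → does d ≡ true → P
does-true (yes p) _ = p

does-false : ∀ {P : Set} (d : Dec P) → does d ≡ false → ¬ P
does-false (no ¬p) _ = ¬p

AllPairs-compare : ∀ {A : Set} {R : A → A → Set} {xs} → AllPairs R xs →
  ∀ {x y} → x ∈ xs → y ∈ xs → x ≡ y ⊎ R x y ⊎ R y x
AllPairs-compare (_ ∷ _)   (here refl) (here refl) = inj₁ refl
AllPairs-compare (Rx ∷ _)  (here refl) (there y∈)  = inj₂ (inj₁ (All.lookup Rx y∈))
AllPairs-compare (Ry ∷ _)  (there x∈)  (here refl) = inj₂ (inj₂ (All.lookup Ry x∈))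
AllPairs-compare (_ ∷ Rxs) (there x∈)  (there y∈)  = AllPairs-compare Rxs x∈ y∈


n<2+2⌊n/2⌋ : ∀ n → n < 2 * suc ⌊ n /2⌋
n<2+2⌊n/2⌋ zero          = s≤s z≤n
n<2+2⌊n/2⌋ (suc zero)    = s≤s (s≤s z≤n)
n<2+2⌊n/2⌋ (suc (suc n)) = begin-strict
  2 + n                 <⟨ +-monoʳ-< 2 (n<2+2⌊n/2⌋ n) ⟩
  2 + 2 * suc ⌊ n /2⌋   ≡⟨ *-suc 2 (suc ⌊ n /2⌋) ⟨
  2 * suc (suc ⌊ n /2⌋) ∎

⌈n/2⌉≤1+⌊n/2⌋ : ∀ n → ⌈ n /2⌉ ≤ suc ⌊ n /2⌋
⌈n/2⌉≤1+⌊n/2⌋ n = ⌊n/2⌋-mono (n≤1+n (suc n))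

2*⌊n/2⌋≤n : ∀ n → 2 * ⌊ n /2⌋ ≤ n
2*⌊n/2⌋≤n n = begin
  2 * ⌊ n /2⌋         ≡⟨ cong (⌊ n /2⌋ +_) (+-identityʳ ⌊ n /2⌋) ⟩
  ⌊ n /2⌋ + ⌊ n /2⌋   ≤⟨ +-monoʳ-≤ ⌊ n /2⌋ (⌊n/2⌋≤⌈n/2⌉ n) ⟩
  ⌊ n /2⌋ + ⌈ n /2⌉   ≡⟨ ⌊n/2⌋+⌈n/2⌉≡n n ⟩
  n                   ∎

-- Both slot bounds end here: each of `k` busy lines supplies `c` units, and all of them fit on `m`
-- machines into `w` time slots. The factor 8 for each of the two kinds gives the ratio 16.
scaled-bound : ∀ {k c m w} → k * c ≤ m * w → w < 8 * c → 0 < m → k < 8 * m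
scaled-bound {k} {c} {m} {w} kc≤mw w<8c 0<m = *-cancelʳ-< c k (8 * m) (begin-strict
  k * c       ≤⟨ kc≤mw ⟩
  m * w       <⟨ *-monoʳ-< m {{>-nonZero 0<m}} w<8c ⟩
  m * (8 * c) ≡⟨ rearrange m c ⟩
  8 * m * c   ∎)
  where
  rearrange : ∀ m c → m * (8 * c) ≡ 8 * m * c
  rearrange = solve-∀

-- A job and an offset name a unit of work; a schedule puts the K * Q units named
-- by f into distinct (machine, time slot) cells.
units-fit : ∀ I {m σ} → FeasibleSchedule I m σ → ∀ {K Q} a w
  (f : Fin K → Fin Q → JobId × ℕ) →
  (∀ κ τ → let (i , o) = f κ τ in IsJob I i × o < p I i
     × a ≤ start σ i + o × start σ i + o < a + w) →
  (∀ κ τ κ′ τ′ → f κ τ ≡ f κ′ τ′ → κ ≡ κ′ × τ ≡ τ′) →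
  K * Q ≤ m * w
units-fit I {m} {σ} (fits , apart) {K} {Q} a w f bounds f-inj =
  Fin.injective⇒≤ {f = cell ∘ remQuot Q} cell-inj
  where
  job-of : Fin K × Fin Q → JobId
  job-of u = proj₁ (uncurry f u)
  slot-of : Fin K × Fin Q → ℕ
  slot-of u = start σ (job-of u) + proj₂ (uncurry f u)
  machine< : ∀ u → machine σ (job-of u) < m
  machine< (κ , τ) = proj₂ (proj₂ (fits _ (proj₁ (bounds κ τ))))
  slot≥ : ∀ u → a ≤ slot-of u
  slot≥ (κ , τ) = proj₁ (proj₂ (proj₂ (bounds κ τ)))
  slot< : ∀ u → slot-of u ∸ a < w
  slot< (κ , τ) = +-cancelˡ-< a _ _
    (subst (_< a + w) (sym (m+[n∸m]≡n (slot≥ (κ , τ)))) (proj₂ (proj₂ (proj₂ (bounds κ τ)))))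
  cell : Fin K × Fin Q → Fin (m * w)
  cell u = combine (fromℕ< (machine< u)) (fromℕ< (slot< u))

  -- Distinct jobs on one machine run in disjoint intervals, so a shared cell forces the same job,
  -- and then the offsets agree.
  same-unit : ∀ {i o i′ o′} → IsJob I i → IsJob I i′ → o < p I i → o′ < p I i′ →
    machine σ i ≡ machine σ i′ → start σ i + o ≡ start σ i′ + o′ → (i , o) ≡ (i′ , o′)
  same-unit {i} {o} {i′} {o′} ji ji′ o< o′< same-machine same-slot with ≡-dec _≟_ _≟_ i i′
  ... | yes refl = cong (i ,_) (+-cancelˡ-≡ (start σ i) o o′ same-slot)
  ... | no i≢i′ with apart i i′ ji ji′ i≢i′ same-machine
  ...   | inj₁ i-first  = contradiction same-slot (<⇒≢ (<-≤-trans (+-monoʳ-< (start σ i) o<)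
                            (≤-trans i-first (m≤m+n _ o′))))
  ...   | inj₂ i′-first = contradiction (sym same-slot) (<⇒≢ (<-≤-trans (+-monoʳ-< (start σ i′) o′<)
                            (≤-trans i′-first (m≤m+n _ o))))

  cell-inj′ : ∀ u u′ → cell u ≡ cell u′ → u ≡ u′
  cell-inj′ u@(κ , τ) u′@(κ′ , τ′) eq
    with e₁ , e₂ ← Fin.combine-injective _ _ _ _ eq
    with e₁′ ← trans (sym (Fin.toℕ-fromℕ< (machine< u))) (trans (cong toℕ e₁) (Fin.toℕ-fromℕ< (machine< u′)))
       | e₂′ ← trans (sym (Fin.toℕ-fromℕ< (slot< u))) (trans (cong toℕ e₂) (Fin.toℕ-fromℕ< (slot< u′)))
    with f-inj κ τ κ′ τ′ (same-unit (proj₁ (bounds κ τ)) (proj₁ (bounds κ′ τ′))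
           (proj₁ (proj₂ (bounds κ τ))) (proj₁ (proj₂ (bounds κ′ τ′))) e₁′
           (∸-cancelʳ-≡ (slot≥ u) (slot≥ u′) e₂′))
  ... | refl , refl = refl

  cell-inj : ∀ {x y} → cell (remQuot Q x) ≡ cell (remQuot Q y) → x ≡ y
  cell-inj {x} {y} eq = trans (sym (Fin.combine-remQuot {K} Q x))
    (trans (cong (uncurry combine) (cell-inj′ _ _ eq)) (Fin.combine-remQuot {K} Q y))

-- The first-fit algorithm.

record Request : Set where
  constructor request
  field
    ident : JobId
    spec  : Job
  rel proc dl span laxity : ℕ
  rel    = r ident
  proc   = Job.proc spec
  dl     = Job.dl spec
  -- The subtractions here truncate; for jobs that some schedule can meet they are exact
  -- (`rel+span`, `rel+proc+laxity`).
  span   = dl ∸ rel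
  laxity = dl ∸ (rel + proc)
open Request

isLoose : Request → Bool
isLoose q = does (4 * proc q ≤? span q)

-- Requests are dispatched in order of ready, and start at or after it; a request only
-- goes to a line on which it can start by latest.
ready latest : Request → ℕ
ready  q = if isLoose q then rel q else rel q + ⌊ laxity q /2⌋
latest q = rel q + ⌊ (if isLoose q then span q else laxity q) /2⌋

record Placement : Set where
  field
    req    : Request
    slot   : ℕ
    begins : ℕ
  ends : ℕ
  ends = begins + proc req
  line : Bool × ℕ
  line = isLoose req , slot
open Placement

_≟-line_ : (μ ν : Bool × ℕ) → Dec (μ ≡ ν)
_≟-line_ = ≡-dec Data.Bool._≟_ _≟_

-- Queues and histories list the latest item first.
completion : List Placement → Bool × ℕ → ℕ
completion []      μ = 0
completion (x ∷ h) μ = if does (line x ≟-line μ) then ends x else completion h μ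

acceptable? : ∀ q h k → Dec (completion h (isLoose q , k) ≤ latest q)
acceptable? q h k = completion h (isLoose q , k) ≤? latest q

place : Request → List Placement → Placement
place q h = record
  { req    = q
  ; slot   = k
  ; begins = ready q ⊔ completion h (isLoose q , k)
  }
  where k = least (acceptable? q h) (length h)

run : List Request → List Placement
run []       = []
run (q ∷ qs) = place q (run qs) ∷ run qs

-- The value on an empty history is a dummy, never reached when `q` occurs in the history.
entry : Request → List Placement → Placement
entry q [] = place q []
entry q (x ∷ h) with ≡-dec _≟_ _≟_ (ident (req x)) (ident q)
... | yes _ = x
... | no  _ = entry q h

requestOf : Instance → JobId → Request
requestOf I (t , k) = request (t , k) (at (batch I t) k)

released : Instance → ℕ → List Request
released I zero    = []
released I (suc t) = map (λ k → requestOf I (t , k)) (upTo (length (batch I t))) ++ released I t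

-- The order is flipped because `run` works from the tail of its list: with decreasing deadlines,
-- the earliest deadline is placed first.
open Sort (On.decTotalOrder (Flip.decTotalOrder ≤-decTotalOrder) dl)
  using (sort; sort-↭; sort-↗)

-- Batches up to time `t` suffice, since no request is ready before its release.
readyAt : Instance → ℕ → List Request
readyAt I t = filter (λ q → ready q ≟ t) (released I (suc t))

queue : Instance → ℕ → List Request
queue I zero    = []
queue I (suc t) = sort (readyAt I t) ++ queue I t

-- Slot `k` of the tight kind is machine `2 * k`, of the loose kind `2 * k + 1`. Interleaving lets
-- both pools grow without a bound known in advance.
machineNumber : Bool × ℕ → ℕ
machineNumber (b , zero)  = if b then 1 else 0
machineNumber (b , suc k) = 2 + machineNumber (b , k)

-- The run stops at the ready time of `j`, so the placement depends only on batches released by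
-- then.
placementOf : Instance → JobId → Placement
placementOf I j = entry (requestOf I j) (run (queue I (suc (ready (requestOf I j)))))

algorithm : Algorithm
algorithm I = sched (begins ∘ placementOf I) (machineNumber ∘ line ∘ placementOf I)

-- Invariants of machine numbering and of a run.

machineNumber-injective : ∀ {μ ν} → machineNumber μ ≡ machineNumber ν → μ ≡ ν
machineNumber-injective {false , zero}  {false , zero}  _  = refl
machineNumber-injective {true  , zero}  {true  , zero}  _  = refl
machineNumber-injective {false , zero}  {true  , zero}  ()
machineNumber-injective {true  , zero}  {false , zero}  ()
machineNumber-injective {false , zero}  {b , suc _}     ()
machineNumber-injective {true  , zero}  {b , suc _}     ()
machineNumber-injective {b , suc _}     {false , zero}  ()
machineNumber-injective {b , suc _}     {true  , zero}  ()
machineNumber-injective {b , suc k}     {b′ , suc k′}   eq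
  with refl ← machineNumber-injective {b , k} {b′ , k′} (suc-injective (suc-injective eq)) = refl

machineNumber-< : ∀ b k → machineNumber (b , k) < 2 * suc k
machineNumber-< false zero = s≤s z≤n
machineNumber-< true  zero = s≤s (s≤s z≤n)
machineNumber-< b (suc k)  = subst (2 + machineNumber (b , k) <_) (sym (*-suc 2 (suc k)))
  (+-monoʳ-< 2 (machineNumber-< b k))

loose⇒ : ∀ q → isLoose q ≡ true → 4 * proc q ≤ span q
loose⇒ q eq = does-true (4 * proc q ≤? span q) eq

tight⇒ : ∀ q → isLoose q ≡ false → span q < 4 * proc q
tight⇒ q eq = ≰⇒> (does-false (4 * proc q ≤? span q) eq)

rel≤ready : ∀ q → rel q ≤ ready q
rel≤ready q with isLoose q
... | true  = ≤-refl
... | false = m≤m+n _ _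

ready≤latest : ∀ q → ready q ≤ latest q
ready≤latest q with isLoose q
... | true  = m≤m+n _ _
... | false = ≤-refl

completion-mono : ∀ q qs μ → completion (run qs) μ ≤ completion (run (q ∷ qs)) μ
completion-mono q qs μ with line (place q (run qs)) ≟-line μ
... | yes refl = ≤-trans (m≤n⊔m (ready q) _) (m≤m+n _ (proc q))
... | no _     = ≤-refl

ends≤completion : ∀ qs {x} → x ∈ run qs → ends x ≤ completion (run qs) (line x)
ends≤completion (q ∷ qs) (here refl) with line (place q (run qs)) ≟-line line (place q (run qs))
... | yes _ = ≤-refl
... | no ≢  = contradiction refl ≢
ends≤completion (q ∷ qs) {x} (there x∈) =
  ≤-trans (ends≤completion qs x∈) (completion-mono q qs (line x))

run-disjoint : ∀ qs → AllPairs (λ x y → line x ≡ line y → ends y ≤ begins x) (run qs)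
run-disjoint []       = []
run-disjoint (q ∷ qs) = All.tabulate later ∷ run-disjoint qs
  where
  later : ∀ {y} → y ∈ run qs → line (place q (run qs)) ≡ line y → ends y ≤ begins (place q (run qs))
  later y∈ eq = ≤-trans (subst (λ μ → _ ≤ completion (run qs) μ) (sym eq) (ends≤completion qs y∈))
    (m≤n⊔m (ready q) _)

-- Each placement takes a slot at most the length of the history before it, so every slot number in
-- a history is below its length.
completion-unused : ∀ qs b {k} → length (run qs) ≤ k → completion (run qs) (b , k) ≡ 0
completion-unused []       b len≤ = refl
completion-unused (q ∷ qs) b {k} len≤ with line (place q (run qs)) ≟-line (b , k)
... | yes refl = contradiction (least-≤ (acceptable? q (run qs)) (length (run qs))) (<⇒≱ len≤)
... | no _     = completion-unused qs b (≤-trans (n≤1+n _) len≤)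

begins≤latest : ∀ q qs → begins (place q (run qs)) ≤ latest q
begins≤latest q qs = ⊔-lub (ready≤latest q)
  (least-holds (acceptable? q (run qs)) (length (run qs))
    (subst (_≤ latest q) (sym (completion-unused qs (isLoose q) ≤-refl)) z≤n))

placement-bounds : ∀ qs {x} → x ∈ run qs → ready (req x) ≤ begins x × begins x ≤ latest (req x)
placement-bounds (q ∷ qs) (here refl) = m≤m⊔n (ready q) _ , begins≤latest q qs
placement-bounds (q ∷ qs) (there x∈)  = placement-bounds qs x∈

map-req-run : ∀ qs → map req (run qs) ≡ qs
map-req-run []       = refl
map-req-run (q ∷ qs) = cong (q ∷_) (map-req-run qs)

req-∈ : ∀ qs {x} → x ∈ run qs → req x ∈ qs
req-∈ qs {x} x∈ = subst (req x ∈_) (map-req-run qs) (∈-map⁺ req x∈)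

-- A placement begins after its ready time only when its line is occupied until then,
-- so after the last ready time the backlog of a line is processed without gaps.
running-before-completion : ∀ qs μ τ → (∀ {q} → q ∈ qs → ready q ≤ τ) → τ < completion (run qs) μ →
  ∃ λ x → x ∈ run qs × line x ≡ μ × begins x ≤ τ × τ < ends x
running-before-completion (q ∷ qs) μ τ ready≤τ τ<C with line (place q (run qs)) ≟-line μ
... | no _ with running-before-completion qs μ τ (ready≤τ ∘ there) τ<C
...   | x , x∈ , rest = x , there x∈ , rest
running-before-completion (q ∷ qs) μ τ ready≤τ τ<C | yes refl with begins (place q (run qs)) ≤? τ
...   | yes b≤τ = place q (run qs) , here refl , refl , b≤τ , τ<C
...   | no  b≰τ with ⊔-sel (ready q) (completion (run qs) μ)
...     | inj₁ eq = contradiction (subst (_≤ τ) (sym eq) (ready≤τ (here refl))) b≰τ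
...     | inj₂ eq with running-before-completion qs μ τ (ready≤τ ∘ there) (subst (τ <_) eq (≰⇒> b≰τ))
...       | x , x∈ , rest = x , there x∈ , rest

-- First fit passed over `κ`, so that line completes after `latest q`; the absence of gaps makes it
-- busy throughout the start window of `q`.
lower-slots-busy : ∀ q qs → (∀ {y} → y ∈ qs → ready y ≤ ready q) →
  ∀ {κ τ} → κ < slot (place q (run qs)) → ready q ≤ τ → τ ≤ latest q →
  ∃ λ x → x ∈ run qs × line x ≡ (isLoose q , κ) × begins x ≤ τ × τ < ends x
lower-slots-busy q qs ready≤ {κ} {τ} κ<slot ready≤τ τ≤latest =
  running-before-completion qs (isLoose q , κ) τ (λ y∈ → ≤-trans (ready≤ y∈) ready≤τ)
    (≤-<-trans τ≤latest (≰⇒> (least-minimal (acceptable? q (run qs)) (length (run qs)) κ<slot)))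

-- Contents and order of the queue.

entry-∈ : ∀ q {h} → q ∈ map req h → entry q h ∈ h × ident (req (entry q h)) ≡ ident q
entry-∈ q {x ∷ h} q∈ with ≡-dec _≟_ _≟_ (ident (req x)) (ident q)
... | yes eq = here refl , eq
entry-∈ q {x ∷ h} (here refl) | no ≢ = contradiction refl ≢
entry-∈ q {x ∷ h} (there q∈)  | no _ with entry-∈ q q∈
... | e∈ , eq = there e∈ , eq

-- Requests carry copies of job data; this ties the copy to the instance, so that a request is
-- determined by its identifier.
Genuine : Instance → Request → Set
Genuine I q = IsJob I (ident q) × q ≡ requestOf I (ident q)

∈-released⁺ : ∀ I {j T} → IsJob I j → r j < T → requestOf I j ∈ released I T
∈-released⁺ I {t , k} {suc T} ij t<T with t ≟ T
... | yes refl = ∈-++⁺ˡ (∈-map⁺ (λ k → requestOf I (T , k)) (∈-upTo⁺ ij))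
... | no t≢T   = ∈-++⁺ʳ _ (∈-released⁺ I ij (≤∧≢⇒< (s≤s⁻¹ t<T) t≢T))

∈-released⁻ : ∀ I T {q} → q ∈ released I T → Genuine I q × rel q < T
∈-released⁻ I (suc T) q∈ with ∈-++⁻ (map (λ k → requestOf I (T , k)) (upTo (length (batch I T)))) q∈
... | inj₂ q∈′ with ∈-released⁻ I T q∈′
...   | gen , rel< = gen , m≤n⇒m≤1+n rel<
∈-released⁻ I (suc T) q∈ | inj₁ q∈′ with ∈-map⁻ (λ k → requestOf I (T , k)) q∈′
...   | k , k∈ , refl = (∈-upTo⁻ k∈ , refl) , ≤-refl

released-unique : ∀ I T → AllPairs _≢_ (released I T)
released-unique I zero    = []
released-unique I (suc T) = AllPairs.++⁺
  (AllPairs.map⁺ (AllPairs.applyUpTo⁺₁ id (length (batch I T)) λ { i<j _ refl → <-irrefl refl i<j }))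
  (released-unique I T)
  (All.tabulate λ {x} x∈ → All.tabulate λ {y} y∈ → λ { refl → <⇒≢ (proj₂ (∈-released⁻ I T y∈)) (rel≡T x∈) })
  where
  rel≡T : ∀ {x} → x ∈ map (λ k → requestOf I (T , k)) (upTo (length (batch I T))) → rel x ≡ T
  rel≡T x∈ with ∈-map⁻ (λ k → requestOf I (T , k)) x∈
  ... | _ , _ , refl = refl

∈-sort-readyAt⁻ : ∀ I t {q} → q ∈ sort (readyAt I t) → Genuine I q × ready q ≡ t
∈-sort-readyAt⁻ I t q∈
  with q∈′ , eq ← ∈-filter⁻ (λ q → ready q ≟ t) {xs = released I (suc t)} (∈-resp-↭ (sort-↭ (readyAt I t)) q∈)
  = proj₁ (∈-released⁻ I (suc t) q∈′) , eq

∈-queue⁺ : ∀ I {j T} → IsJob I j → ready (requestOf I j) < T → requestOf I j ∈ queue I T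
∈-queue⁺ I {j} {suc T} ij ready< with ready (requestOf I j) ≟ T
... | yes eq = ∈-++⁺ˡ (∈-resp-↭ (↭-sym (sort-↭ (readyAt I T)))
                 (∈-filter⁺ (λ q → ready q ≟ T)
                   (∈-released⁺ I ij (≤-<-trans (rel≤ready (requestOf I j)) ready<)) eq))
... | no  ≢T = ∈-++⁺ʳ _ (∈-queue⁺ I ij (≤∧≢⇒< (s≤s⁻¹ ready<) ≢T))

∈-queue⁻ : ∀ I T {q} → q ∈ queue I T → Genuine I q × ready q < T
∈-queue⁻ I (suc T) q∈ with ∈-++⁻ (sort (readyAt I T)) q∈
... | inj₁ q∈′ with ∈-sort-readyAt⁻ I T q∈′
...   | gen , refl = gen , ≤-refl
∈-queue⁻ I (suc T) q∈ | inj₂ q∈′ with ∈-queue⁻ I T q∈′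
...   | gen , ready< = gen , m≤n⇒m≤1+n ready<

-- `Agreeable` leaves jobs of equal release date unrelated. The tie-break makes deadlines monotone
-- among loose jobs as well, as `loose-order` requires.
Precedes : Request → Request → Set
Precedes y x = ready y < ready x ⊎ (ready y ≡ ready x × dl y ≤ dl x)

queue-unique : ∀ I T → AllPairs _≢_ (queue I T)
queue-unique I zero    = []
queue-unique I (suc T) = AllPairs.++⁺
  (↭ₛ.Unique-resp-↭ (setoid Request) (↭⇒↭ₛ (↭-sym (sort-↭ (readyAt I T))))
    (AllPairs.filter⁺ (λ q → ready q ≟ T) (released-unique I (suc T))))
  (queue-unique I T)
  (All.tabulate λ x∈ → All.tabulate λ y∈ → λ { refl →
    <⇒≢ (proj₂ (∈-queue⁻ I T y∈)) (proj₂ (∈-sort-readyAt⁻ I T x∈)) })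

queue-ordered : ∀ I T → AllPairs (λ x y → Precedes y x) (queue I T)
queue-ordered I zero    = []
queue-ordered I (suc T) = AllPairs.++⁺
  (strengthen (Linked⇒AllPairs (λ {x y z} p q → ≤-trans {dl z} {dl y} {dl x} q p) (sort-↗ (readyAt I T)))
    (proj₂ ∘ ∈-sort-readyAt⁻ I T))
  (queue-ordered I T)
  (All.tabulate λ x∈ → All.tabulate λ y∈ →
    inj₁ (subst (_ <_) (sym (proj₂ (∈-sort-readyAt⁻ I T x∈))) (proj₂ (∈-queue⁻ I T y∈))))
  where
  strengthen : ∀ {xs} → AllPairs (λ x y → dl y ≤ dl x) xs → (∀ {x} → x ∈ xs → ready x ≡ T) →
    AllPairs (λ x y → Precedes y x) xs
  strengthen []         at-T = []
  strengthen (Rx ∷ Rxs) at-T =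
    All.tabulate (λ y∈ → inj₂ (trans (at-T (there y∈)) (sym (at-T (here refl))) , All.lookup Rx y∈))
    ∷ strengthen Rxs (at-T ∘ there)

-- Inequalities for loose and tight windows.

loose-release-bound : ∀ {r L p s rⱼ Lⱼ} → s ≤ r + ⌊ L /2⌋ → rⱼ < s + p → 4 * p ≤ L →
  r + L ≤ rⱼ + Lⱼ → rⱼ ≤ r + 3 * Lⱼ
-- The earlier job ends by `r + 3L/4` and is still running at `rⱼ`, so at least `L/4` of its window
-- lies after `rⱼ`. Its deadline is at most `rⱼ + Lⱼ`, whence `L/4 ≤ Lⱼ` and
-- `rⱼ ≤ r + 3L/4 ≤ r + 3Lⱼ`. Adding `3 * rⱼ` to both sides avoids fractions.
loose-release-bound {r} {L} {p} {s} {rⱼ} {Lⱼ} s≤ rⱼ< 4p≤L d≤dⱼ = +-cancelˡ-≤ (3 * rⱼ) _ _ (begin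
  3 * rⱼ + rⱼ                        ≡⟨ fourfold rⱼ ⟩
  4 * rⱼ                             ≤⟨ *-monoʳ-≤ 4 (<⇒≤ rⱼ<) ⟩
  4 * (s + p)                        ≤⟨ *-monoʳ-≤ 4 (+-monoˡ-≤ p s≤) ⟩
  4 * (r + ⌊ L /2⌋ + p)              ≡⟨ expand r ⌊ L /2⌋ p ⟩
  4 * r + (2 * (2 * ⌊ L /2⌋) + 4 * p) ≤⟨ +-monoʳ-≤ (4 * r) (+-mono-≤ (*-monoʳ-≤ 2 (2*⌊n/2⌋≤n L)) 4p≤L) ⟩
  4 * r + (2 * L + L)                ≡⟨ regroup r L ⟩
  r + 3 * (r + L)                    ≤⟨ +-monoʳ-≤ r (*-monoʳ-≤ 3 d≤dⱼ) ⟩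
  r + 3 * (rⱼ + Lⱼ)                  ≡⟨ commute r rⱼ Lⱼ ⟩
  3 * rⱼ + (r + 3 * Lⱼ)              ∎)
  where
  fourfold : ∀ a → 3 * a + a ≡ 4 * a
  fourfold = solve-∀
  expand : ∀ a b c → 4 * (a + b + c) ≡ 4 * a + (2 * (2 * b) + 4 * c)
  expand = solve-∀
  regroup : ∀ a b → 4 * a + (2 * b + b) ≡ a + 3 * (a + b)
  regroup = solve-∀
  commute : ∀ a b c → a + 3 * (b + c) ≡ 3 * b + (a + 3 * c)
  commute = solve-∀

-- The window of a job run in its middle: `⌊ l /2⌋` idle, then `p` of processing, then slack
-- `⌈ l /2⌉`.
medium-fit-split : ∀ r p l → r + p + l ≡ r + ⌊ l /2⌋ + p + ⌈ l /2⌉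
medium-fit-split r p l = trans (cong (r + p +_) (sym (⌊n/2⌋+⌈n/2⌉≡n l))) (rearrange r p ⌊ l /2⌋ ⌈ l /2⌉)
  where
  rearrange : ∀ r p a b → r + p + (a + b) ≡ r + a + p + b
  rearrange = solve-∀

-- Here s is the start of a job in an arbitrary schedule; r + ⌊ l /2⌋ is its start in the
-- algorithm, which is processing it at time t.
near-if-due-early : ∀ {r p l s t X} → r ≤ s → s + p ≤ r + p + l → t < r + ⌊ l /2⌋ + p →
  r + p + l ≤ t + X → t ≤ s + p + X × s ≤ t + X
near-if-due-early {r} {p} {l} {s} {t} {X} r≤s c≤d t<e d≤t+X = t≤ , ≤-trans (m≤m+n s p) (≤-trans c≤d d≤t+X)
  where
  ⌈l/2⌉≤X : ⌈ l /2⌉ ≤ X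
  ⌈l/2⌉≤X = +-cancelˡ-≤ t _ _ (begin
    t + ⌈ l /2⌉                 ≤⟨ +-monoˡ-≤ ⌈ l /2⌉ (<⇒≤ t<e) ⟩
    r + ⌊ l /2⌋ + p + ⌈ l /2⌉   ≡⟨ medium-fit-split r p l ⟨
    r + p + l                   ≤⟨ d≤t+X ⟩
    t + X                       ∎)
  rearrange : ∀ r p a → r + a + p ≡ r + p + a
  rearrange = solve-∀
  t≤ : t ≤ s + p + X
  t≤ = begin
    t                   ≤⟨ <⇒≤ t<e ⟩
    r + ⌊ l /2⌋ + p     ≡⟨ rearrange r p ⌊ l /2⌋ ⟩
    r + p + ⌊ l /2⌋     ≤⟨ +-mono-≤ (+-monoˡ-≤ p r≤s) (≤-trans (⌊n/2⌋≤⌈n/2⌉ l) ⌈l/2⌉≤X) ⟩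
    s + p + X           ∎

-- The mirror case. A release after `t − X` bounds the completion from below. It also leaves less
-- than `X` of idle time before the middle start, hence at most `X` of slack after it, which bounds
-- the latest possible start.
near-if-released-late : ∀ {r p l s t X} → r ≤ s → s + p ≤ r + p + l → r + ⌊ l /2⌋ ≤ t →
  t < r + X → t ≤ s + p + X × s ≤ t + X
near-if-released-late {r} {p} {l} {s} {t} {X} r≤s c≤d b≤t t<r+X =
  ≤-trans (<⇒≤ t<r+X) (+-monoˡ-≤ X (≤-trans r≤s (m≤m+n s p))) , +-cancelʳ-≤ p _ _ (begin
    s + p                        ≤⟨ c≤d ⟩
    r + p + l                    ≡⟨ medium-fit-split r p l ⟩
    r + ⌊ l /2⌋ + p + ⌈ l /2⌉    ≡⟨ rearrange (r + ⌊ l /2⌋) p ⌈ l /2⌉ ⟩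
    -- The strict `t < r + X` pays for rounding up the second half.
    r + ⌊ l /2⌋ + ⌈ l /2⌉ + p    ≤⟨ +-monoˡ-≤ p (+-mono-≤ b≤t (≤-trans (⌈n/2⌉≤1+⌊n/2⌋ l) 1+⌊l/2⌋≤X)) ⟩
    t + X + p                    ∎)
  where
  rearrange : ∀ a b c → a + b + c ≡ a + c + b
  rearrange = solve-∀
  1+⌊l/2⌋≤X : suc ⌊ l /2⌋ ≤ X
  1+⌊l/2⌋≤X = +-cancelˡ-< r _ _ (≤-<-trans b≤t t<r+X)

-- A job that ends no earlier than `t − X` and starts no later than `t + X` has `q` consecutive
-- units inside the window of length `2 * (X + q)` centred at `t`, beginning at `u`. The left end
-- `a` is truncated at zero.
module _ {s p t X q : ℕ} (t≤c+X : t ≤ s + p + X) (s≤t+X : s ≤ t + X) (q≤p : q ≤ p) where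
  private
    a = t ∸ (X + q)
    u = s ⊔ a

  clipped-start-fits : u + q ≤ s + p
  clipped-start-fits = subst (_≤ s + p) (sym (+-distribʳ-⊔ q s a)) (⊔-lub (+-monoʳ-≤ s q≤p) a+q≤c)
    where
    a+q≤c : a + q ≤ s + p
    a+q≤c with ≤-total t (X + q)
    -- Here the window is cut off at time zero, and `q ≤ p` alone suffices.
    ... | inj₁ t≤ = subst (λ a → a + q ≤ s + p) (sym (m≤n⇒m∸n≡0 t≤)) (≤-trans q≤p (m≤n+m p s))
    ... | inj₂ t≥ = +-cancelʳ-≤ X _ _ (subst (_≤ s + p + X)
      (sym (trans (rearrange a q X) (m∸n+n≡m t≥))) t≤c+X)
      where
      rearrange : ∀ a q X → a + q + X ≡ a + (X + q)
      rearrange = solve-∀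

  clipped-slot-< : ∀ {o} → o < q → u + o < a + 2 * (X + q)
  clipped-slot-< {o} o<q = begin-strict
    u + o                   <⟨ +-monoʳ-< u o<q ⟩
    u + q                   ≤⟨ +-monoˡ-≤ q (⊔-lub s≤t+X (≤-trans (m∸n≤m t (X + q)) (m≤m+n t X))) ⟩
    t + X + q               ≤⟨ +-monoˡ-≤ q (+-monoˡ-≤ X (m≤n+m∸n t (X + q))) ⟩
    X + q + a + X + q       ≡⟨ rearrange X q a ⟩
    a + 2 * (X + q)         ∎
    where
    rearrange : ∀ X q a → X + q + a + X + q ≡ a + 2 * (X + q)
    rearrange = solve-∀

-- Tightness means `l < 3 * q`, so the window is about `4 * q + l < 7 * q`; one further `q ≥ 1`
-- absorbs the rounding of `l / 2`.
tight-window-< : ∀ {q l} → q + l < 4 * q → 0 < q → 2 * (q + ⌈ l /2⌉ + q) < 8 * q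
tight-window-< {q} {l} q+l<4q 0<q = begin-strict
  2 * (q + ⌈ l /2⌉ + q)   ≡⟨ expand q ⌈ l /2⌉ ⟩
  4 * q + 2 * ⌈ l /2⌉     ≤⟨ +-monoʳ-≤ (4 * q) (2*⌊n/2⌋≤n (suc l)) ⟩
  4 * q + suc l           ≤⟨ +-monoʳ-≤ (4 * q) (+-monoˡ-≤ l 0<q) ⟩
  4 * q + (q + l)         <⟨ +-monoʳ-< (4 * q) q+l<4q ⟩
  4 * q + 4 * q           ≡⟨ double q ⟩
  8 * q                   ∎
  where
  expand : ∀ q c → 2 * (q + c + q) ≡ 4 * q + 2 * c
  expand = solve-∀
  double : ∀ q → 4 * q + 4 * q ≡ 8 * q
  double = solve-∀

ready-loose : ∀ q → isLoose q ≡ true → ready q ≡ rel q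
ready-loose q eq rewrite eq = refl

latest-loose : ∀ q → isLoose q ≡ true → latest q ≡ rel q + ⌊ span q /2⌋
latest-loose q eq rewrite eq = refl

ready-tight : ∀ q → isLoose q ≡ false → ready q ≡ rel q + ⌊ laxity q /2⌋
ready-tight q eq rewrite eq = refl

latest-tight : ∀ q → isLoose q ≡ false → latest q ≡ rel q + ⌊ laxity q /2⌋
latest-tight q eq rewrite eq = refl

-- Bounding slots against an arbitrary feasible schedule `σ`.

module Analysis (I : Instance) {m : ℕ} {σ : Schedule}
  (agreeable : AgreeableInstance I) (feasible : FeasibleSchedule I m σ) where

  module _ {q : Request} (genuine : Genuine I q) where
    private
      p≡ : p I (ident q) ≡ proc q
      p≡ = cong proc (sym (proj₂ genuine))
      d≡ : d I (ident q) ≡ dl q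
      d≡ = cong dl (sym (proj₂ genuine))

    proc-genuine : proc q ≡ p I (ident q)
    proc-genuine = sym p≡

    rel≤start : rel q ≤ start σ (ident q)
    rel≤start = proj₁ (proj₁ feasible (ident q) (proj₁ genuine))

    completes : start σ (ident q) + proc q ≤ dl q
    completes = subst₂ (λ x y → start σ (ident q) + x ≤ y) p≡ d≡
      (proj₁ (proj₂ (proj₁ feasible (ident q) (proj₁ genuine))))

    0<m : 0 < m
    0<m = ≤-<-trans z≤n (proj₂ (proj₂ (proj₁ feasible (ident q) (proj₁ genuine))))

    0<proc : 0 < proc q
    0<proc = subst (0 <_) p≡ (proj₁ agreeable (ident q) (proj₁ genuine))

    rel+proc≤dl : rel q + proc q ≤ dl q
    rel+proc≤dl = ≤-trans (+-monoˡ-≤ (proc q) rel≤start) completes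

    rel+span : rel q + span q ≡ dl q
    rel+span = m+[n∸m]≡n (≤-trans (m≤m+n _ (proc q)) rel+proc≤dl)

    rel+proc+laxity : rel q + proc q + laxity q ≡ dl q
    rel+proc+laxity = m+[n∸m]≡n rel+proc≤dl

    span-split : span q ≡ proc q + laxity q
    span-split = +-cancelˡ-≡ (rel q) _ _
      (trans rel+span (trans (sym rel+proc+laxity) (+-assoc (rel q) (proc q) (laxity q))))

    -- A tight job started in the middle still has half its laxity; a loose job started halfway
    -- through its window needs at most a further quarter.
    latest-meets-deadline : latest q + proc q ≤ dl q
    latest-meets-deadline with isLoose q in eq
    ... | false = begin
      rel q + ⌊ laxity q /2⌋ + proc q                    ≤⟨ m≤m+n _ ⌈ laxity q /2⌉ ⟩
      rel q + ⌊ laxity q /2⌋ + proc q + ⌈ laxity q /2⌉   ≡⟨ medium-fit-split (rel q) (proc q) (laxity q) ⟨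
      rel q + proc q + laxity q                          ≡⟨ rel+proc+laxity ⟩
      dl q                                               ∎
    ... | true = subst (rel q + ⌊ span q /2⌋ + proc q ≤_) rel+span
      (subst (_≤ rel q + span q) (sym (+-assoc (rel q) ⌊ span q /2⌋ (proc q)))
        (+-monoʳ-≤ (rel q) (*-cancelˡ-≤ 4 (begin
          4 * (⌊ span q /2⌋ + proc q)               ≡⟨ expand ⌊ span q /2⌋ (proc q) ⟩
          2 * (2 * ⌊ span q /2⌋) + 4 * proc q       ≤⟨ +-mono-≤ (*-monoʳ-≤ 2 (2*⌊n/2⌋≤n (span q))) (loose⇒ q eq) ⟩
          2 * span q + span q                       ≤⟨ m≤m+n _ (span q) ⟩
          2 * span q + span q + span q              ≡⟨ collect (span q) ⟩
          4 * span q                                ∎))))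
      where
      expand : ∀ a b → 4 * (a + b) ≡ 2 * (2 * a) + 4 * b
      expand = solve-∀
      collect : ∀ a → 2 * a + a + a ≡ 4 * a
      collect = solve-∀

  rel<⇒dl≤ : ∀ {x y} → Genuine I x → Genuine I y → rel x < rel y → dl x ≤ dl y
  rel<⇒dl≤ (jx , ex) (jy , ey) rel< =
    subst₂ _≤_ (cong dl (sym ex)) (cong dl (sym ey)) (proj₂ agreeable _ _ jx jy rel<)

  -- Loose jobs are ready at release: distinct release dates are handled by agreeability, equal ones
  -- by the tie-break.
  loose-order : ∀ {y x} → Genuine I y → Genuine I x → isLoose y ≡ true → isLoose x ≡ true →
    Precedes y x → rel y ≤ rel x × dl y ≤ dl x
  loose-order {y} {x} gy gx ly lx y≺x with subst₂ (λ a b → a < b ⊎ (a ≡ b × dl y ≤ dl x))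
                                             (ready-loose y ly) (ready-loose x lx) y≺x
  ... | inj₁ rel<         = <⇒≤ rel< , rel<⇒dl≤ gy gx rel<
  ... | inj₂ (rel≡ , dl≤) = ≤-reflexive rel≡ , dl≤

  module SlotBound (q : Request) (qs : List Request) (gq : Genuine I q)
    (gqs : ∀ {y} → y ∈ qs → Genuine I y) (unique : AllPairs _≢_ qs)
    (first : ∀ {y} → y ∈ qs → Precedes y q) where

    k : ℕ
    k = slot (place q (run qs))

    ready-first : ∀ {y} → y ∈ qs → ready y ≤ ready q
    ready-first y∈ with first y∈
    ... | inj₁ ready<       = <⇒≤ ready<
    ... | inj₂ (ready≡ , _) = ≤-reflexive ready≡

    genuine : ∀ {x} → x ∈ run qs → Genuine I (req x)
    genuine x∈ = gqs (req-∈ qs x∈)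

    -- This keeps the unit counts injective: a job lies on one line only, so units taken from
    -- different lines belong to different jobs.
    same-ident : ∀ {x y} → x ∈ run qs → y ∈ run qs → ident (req x) ≡ ident (req y) → x ≡ y
    same-ident {x} {y} x∈ y∈ eq
      with AllPairs-compare (AllPairs.map⁻ (subst (AllPairs _≢_) (sym (map-req-run qs)) unique)) x∈ y∈
         | trans (proj₂ (genuine x∈)) (trans (cong (requestOf I) eq) (sym (proj₂ (genuine y∈))))
    ... | inj₁ x≡y          | _  = x≡y
    ... | inj₂ (inj₁ req≢)  | rq = contradiction rq req≢
    ... | inj₂ (inj₂ req≢)  | rq = contradiction (sym rq) req≢

    -- Every lower slot is busy at each of the `⌊ L /2⌋ + 1` instants from `rel q` to `latest q`. In
    -- `σ` this work lies between `rel q − 3L` and `rel q + L`, and `4L < 8 (⌊ L /2⌋ + 1)`.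
    slot-bound-loose : isLoose q ≡ true → k < 8 * m
    slot-bound-loose lq = scaled-bound {k} {suc ⌊ L /2⌋} {m} {4 * L}
      (units-fit I feasible a (4 * L) unit bounds unit-inj)
      (subst (4 * L <_) (sym (*-assoc 4 2 (suc ⌊ L /2⌋))) (*-monoʳ-< 4 (n<2+2⌊n/2⌋ L)))
      (0<m gq)
      where
      L = span q
      a = rel q ∸ 3 * L

      busy : (κ : Fin k) (τ : Fin (suc ⌊ L /2⌋)) → ∃ λ x → x ∈ run qs × line x ≡ (isLoose q , toℕ κ)
        × begins x ≤ rel q + toℕ τ × rel q + toℕ τ < ends x
      busy κ τ = lower-slots-busy q qs ready-first (Fin.toℕ<n κ)
        (subst (_≤ rel q + toℕ τ) (sym (ready-loose q lq)) (m≤m+n _ _))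
        (subst (rel q + toℕ τ ≤_) (sym (latest-loose q lq)) (+-monoʳ-≤ (rel q) (s≤s⁻¹ (Fin.toℕ<n τ))))

      -- The unit that line `κ` processes at time `rel q + τ` in the algorithm; its offset within
      -- the job locates the same unit in `σ`.
      unit : Fin k → Fin (suc ⌊ L /2⌋) → JobId × ℕ
      unit κ τ with x , _ ← busy κ τ = ident (req x) , rel q + toℕ τ ∸ begins x

      bounds : ∀ κ τ → let (i , o) = unit κ τ in IsJob I i × o < p I i
        × a ≤ start σ i + o × start σ i + o < a + 4 * L
      bounds κ τ with x , x∈ , x-line , b≤ , <e ← busy κ τ =
        proj₁ gx , subst (o <_) (proc-genuine gx) o<proc ,
        ≤-trans a≤rel (≤-trans (rel≤start gx) (m≤m+n _ o)) , slot<
        where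
        o = rel q + toℕ τ ∸ begins x
        gx = genuine x∈
        lx : isLoose (req x) ≡ true
        lx = trans (proj₁ (,-injective x-line)) lq
        o<proc : o < proc (req x)
        o<proc = +-cancelˡ-< (begins x) _ _ (subst (_< ends x) (sym (m+[n∸m]≡n b≤)) <e)
        dl≤ : dl (req x) ≤ rel q + L
        dl≤ = subst (dl (req x) ≤_) (sym (rel+span gq)) (proj₂ (loose-order gx gq lx lq (first (req-∈ qs x∈))))
        rel-bound : rel q ≤ rel (req x) + 3 * L
        rel-bound = loose-release-bound {L = span (req x)} {p = proc (req x)} {s = begins x}
          (subst (begins x ≤_) (latest-loose (req x) lx) (proj₂ (placement-bounds qs x∈)))
          (≤-<-trans (m≤m+n _ (toℕ τ)) <e) (loose⇒ (req x) lx)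
          (subst (_≤ rel q + L) (sym (rel+span gx)) dl≤)
        a≤rel : a ≤ rel (req x)
        a≤rel = m≤n+o⇒m∸n≤o (rel q) (3 * L) (subst (rel q ≤_) (+-comm (rel (req x)) (3 * L)) rel-bound)
        rearrange : ∀ L a → 3 * L + a + L ≡ a + 4 * L
        rearrange = solve-∀
        slot< : start σ (ident (req x)) + o < a + 4 * L
        slot< = begin-strict
          start σ (ident (req x)) + o              <⟨ +-monoʳ-< _ o<proc ⟩
          start σ (ident (req x)) + proc (req x)   ≤⟨ completes gx ⟩
          dl (req x)                               ≤⟨ dl≤ ⟩
          rel q + L                                ≤⟨ +-monoˡ-≤ L (m≤n+m∸n (rel q) (3 * L)) ⟩
          3 * L + a + L                            ≡⟨ rearrange L a ⟩
          a + 4 * L                                ∎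

      unit-inj : ∀ κ τ κ′ τ′ → unit κ τ ≡ unit κ′ τ′ → κ ≡ κ′ × τ ≡ τ′
      unit-inj κ τ κ′ τ′ eq
        with x , x∈ , x-line , x≤ , _ ← busy κ τ
           | y , y∈ , y-line , y≤ , _ ← busy κ′ τ′
        with ident≡ , o≡ ← ,-injective eq
        with refl ← same-ident x∈ y∈ ident≡ =
          Fin.toℕ-injective (proj₂ (,-injective (trans (sym x-line) y-line))) ,
          Fin.toℕ-injective (+-cancelˡ-≡ (rel q) _ _ (∸-cancelʳ-≡ x≤ y≤ o≡))

    -- The lower slots are all busy at ready q; the shortest of their jobs sets the scale of
    -- a window in which every feasible schedule processes a comparable part of each.
    slot-bound-tight : isLoose q ≡ false → k < 8 * m
    slot-bound-tight tq = bound k busy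
      where
      t = ready q

      busy : (κ : Fin k) → ∃ λ x → x ∈ run qs × line x ≡ (isLoose q , toℕ κ) × begins x ≤ t × t < ends x
      busy κ = lower-slots-busy q qs ready-first (Fin.toℕ<n κ) ≤-refl (ready≤latest q)

      -- `k` is generalised to `K` to allow a case split, since `argmin` needs a nonempty family.
      bound : ∀ K → ((κ : Fin K) → ∃ λ x → x ∈ run qs × line x ≡ (isLoose q , toℕ κ)
        × begins x ≤ t × t < ends x) → K < 8 * m
      bound zero    busy = <-≤-trans (0<m gq) (m≤n*m m 8)
      bound (suc K) busy with argmin (proc ∘ req ∘ proj₁ ∘ busy)
      ... | κ₀ , shortest = scaled-bound {suc K} {c} {m} {2 * (X + c)}
        (units-fit I feasible a (2 * (X + c)) unit bounds unit-inj)
        (tight-window-< (subst (_< 4 * c) (span-split (g κ₀)) (tight⇒ (Q κ₀) (tight κ₀))) (0<proc (g κ₀)))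
        (0<m gq)
        where
        x : Fin (suc K) → Placement
        x κ = proj₁ (busy κ)
        Q : Fin (suc K) → Request
        Q κ = req (x κ)
        x∈ : ∀ κ → x κ ∈ run qs
        x∈ κ = proj₁ (proj₂ (busy κ))
        x-line : ∀ κ → line (x κ) ≡ (isLoose q , toℕ κ)
        x-line κ = proj₁ (proj₂ (proj₂ (busy κ)))
        g : ∀ κ → Genuine I (Q κ)
        g κ = genuine (x∈ κ)
        tight : ∀ κ → isLoose (Q κ) ≡ false
        tight κ = trans (proj₁ (,-injective (x-line κ))) tq
        -- `ready` and `latest` coincide for tight jobs, which forces the middle start.
        begins≡ : ∀ κ → begins (x κ) ≡ rel (Q κ) + ⌊ laxity (Q κ) /2⌋
        begins≡ κ = ≤-antisym
          (subst (begins (x κ) ≤_) (latest-tight (Q κ) (tight κ)) (proj₂ (placement-bounds qs (x∈ κ))))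
          (subst (_≤ begins (x κ)) (ready-tight (Q κ) (tight κ)) (proj₁ (placement-bounds qs (x∈ κ))))
        begun : ∀ κ → rel (Q κ) + ⌊ laxity (Q κ) /2⌋ ≤ t
        begun κ = subst (_≤ t) (begins≡ κ) (proj₁ (proj₂ (proj₂ (proj₂ (busy κ)))))
        unfinished : ∀ κ → t < rel (Q κ) + ⌊ laxity (Q κ) /2⌋ + proc (Q κ)
        unfinished κ = subst (λ b → t < b + proc (Q κ)) (begins≡ κ) (proj₂ (proj₂ (proj₂ (proj₂ (busy κ)))))

        c l₀ X a : ℕ
        c  = proc (Q κ₀)
        l₀ = laxity (Q κ₀)
        -- The shortest job runs at `t` in the middle of its window, so its release date and its
        -- deadline are both within `X` of `t`.
        X  = c + ⌈ l₀ /2⌉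
        a  = t ∸ (X + c)

        s : Fin (suc K) → ℕ
        s κ = start σ (ident (Q κ))

        due-soon : dl (Q κ₀) ≤ t + X
        due-soon = begin
          dl (Q κ₀)                                        ≡⟨ rel+proc+laxity (g κ₀) ⟨
          rel (Q κ₀) + c + l₀                              ≡⟨ medium-fit-split (rel (Q κ₀)) c l₀ ⟩
          rel (Q κ₀) + ⌊ l₀ /2⌋ + c + ⌈ l₀ /2⌉             ≤⟨ +-monoˡ-≤ ⌈ l₀ /2⌉ (+-monoˡ-≤ c (begun κ₀)) ⟩
          t + c + ⌈ l₀ /2⌉                                 ≡⟨ +-assoc t c ⌈ l₀ /2⌉ ⟩
          t + X                                            ∎
        released-recently : t < rel (Q κ₀) + X
        released-recently = begin-strict
          t                                 <⟨ unfinished κ₀ ⟩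
          rel (Q κ₀) + ⌊ l₀ /2⌋ + c         ≤⟨ +-monoˡ-≤ c (+-monoʳ-≤ (rel (Q κ₀)) (⌊n/2⌋≤⌈n/2⌉ l₀)) ⟩
          rel (Q κ₀) + ⌈ l₀ /2⌉ + c         ≡⟨ +-assoc (rel (Q κ₀)) ⌈ l₀ /2⌉ c ⟩
          rel (Q κ₀) + (⌈ l₀ /2⌉ + c)       ≡⟨ cong (rel (Q κ₀) +_) (+-comm ⌈ l₀ /2⌉ c) ⟩
          rel (Q κ₀) + X                    ∎

        -- A job released before the shortest one is due no later than it, hence by `t + X`; any
        -- other is released no earlier than it, hence after `t − X`.
        near : ∀ κ → t ≤ s κ + proc (Q κ) + X × s κ ≤ t + X
        near κ = by-agreeability
          where
          meets : s κ + proc (Q κ) ≤ rel (Q κ) + proc (Q κ) + laxity (Q κ)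
          meets = subst (s κ + proc (Q κ) ≤_) (sym (rel+proc+laxity (g κ))) (completes (g κ))
          by-agreeability : t ≤ s κ + proc (Q κ) + X × s κ ≤ t + X
          by-agreeability with rel (Q κ) <? rel (Q κ₀)
          ... | yes rel< = near-if-due-early (rel≤start (g κ)) meets (unfinished κ)
            (≤-trans (≤-reflexive (rel+proc+laxity (g κ))) (≤-trans (rel<⇒dl≤ (g κ) (g κ₀) rel<) due-soon))
          ... | no rel≮ = near-if-released-late {l = laxity (Q κ)} (rel≤start (g κ)) meets (begun κ)
            (<-≤-trans released-recently (+-monoˡ-≤ X (≮⇒≥ rel≮)))

        -- The leading time slots of the job in `σ` that fall before the window.
        skip : Fin (suc K) → ℕ
        skip κ = s κ ⊔ a ∸ s κ

        clipped : ∀ κ o → s κ + (skip κ + o) ≡ s κ ⊔ a + o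
        clipped κ o = trans (sym (+-assoc (s κ) (skip κ) o)) (cong (_+ o) (m+[n∸m]≡n (m≤m⊔n (s κ) a)))

        unit : Fin (suc K) → Fin c → JobId × ℕ
        unit κ o = ident (Q κ) , skip κ + toℕ o

        bounds : ∀ κ o → let (i , o) = unit κ o in IsJob I i × o < p I i
          × a ≤ start σ i + o × start σ i + o < a + 2 * (X + c)
        bounds κ o =
          proj₁ (g κ) ,
          subst (skip κ + toℕ o <_) (proc-genuine (g κ)) (+-cancelˡ-< (s κ) _ _
            (subst (_< s κ + proc (Q κ)) (sym (clipped κ (toℕ o)))
              (<-≤-trans (+-monoʳ-< _ (Fin.toℕ<n o))
                (clipped-start-fits (proj₁ (near κ)) (proj₂ (near κ)) (shortest κ))))) ,
          subst (a ≤_) (sym (clipped κ (toℕ o))) (≤-trans (m≤n⊔m (s κ) a) (m≤m+n _ _)) ,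
          subst (_< a + 2 * (X + c)) (sym (clipped κ (toℕ o)))
            (clipped-slot-< (proj₁ (near κ)) (proj₂ (near κ)) (shortest κ) (Fin.toℕ<n o))

        unit-inj : ∀ κ o κ′ o′ → unit κ o ≡ unit κ′ o′ → κ ≡ κ′ × o ≡ o′
        unit-inj κ o κ′ o′ eq with ident≡ , o≡ ← ,-injective eq
          with refl ← Fin.toℕ-injective (proj₂ (,-injective (trans (sym (x-line κ))
                 (trans (cong line (same-ident (x∈ κ) (x∈ κ′) ident≡)) (x-line κ′)))))
          = refl , Fin.toℕ-injective (+-cancelˡ-≡ (skip κ) _ _ o≡)

    slot-bound : k < 8 * m
    slot-bound = by-pool (isLoose q) refl
      where
      by-pool : ∀ b → isLoose q ≡ b → k < 8 * m
      by-pool true  = slot-bound-loose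
      by-pool false = slot-bound-tight

  slots-bounded : ∀ qs → (∀ {y} → y ∈ qs → Genuine I y) → AllPairs _≢_ qs →
    AllPairs (λ x y → Precedes y x) qs → ∀ {x} → x ∈ run qs → slot x < 8 * m
  slots-bounded (q ∷ qs) gen (_ ∷ unique) (first ∷ _) (here refl) =
    SlotBound.slot-bound q qs (gen (here refl)) (gen ∘ there) unique (All.lookup first)
  slots-bounded (q ∷ qs) gen (_ ∷ unique) (_ ∷ ordered) (there x∈) =
    slots-bounded qs (gen ∘ there) unique ordered x∈

-- Feasibility and the competitive ratio.

run-++ : ∀ ps {qs x} → x ∈ run qs → x ∈ run (ps ++ qs)
run-++ []       x∈ = x∈
run-++ (q ∷ ps) x∈ = there (run-++ ps x∈)

-- Later requests go in front, and a placement depends only on the requests behind it, so decisions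
-- are never revised.
run-queue-mono : ∀ I {T T′ x} → T ≤ T′ → x ∈ run (queue I T) → x ∈ run (queue I T′)
run-queue-mono I {T} {T′} T≤T′ x∈ = extend (≤⇒≤′ T≤T′)
  where
  extend : ∀ {T′} → T ≤′ T′ → _ ∈ run (queue I T′)
  extend ≤′-refl              = x∈
  extend (≤′-step {n} T≤′n) = run-++ (sort (readyAt I n)) (extend T≤′n)

placementOf-∈ : ∀ I {j} → IsJob I j → ∀ {T} → ready (requestOf I j) < T → placementOf I j ∈ run (queue I T)
placementOf-∈ I {j} ij ready<T = run-queue-mono I ready<T (proj₁ (entry-∈ (requestOf I j)
  (subst (requestOf I j ∈_) (sym (map-req-run _)) (∈-queue⁺ I ij ≤-refl))))

req-placementOf : ∀ I {j} → IsJob I j → req (placementOf I j) ≡ requestOf I j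
req-placementOf I {j} ij = trans (proj₂ (proj₁ (∈-queue⁻ I T (req-∈ (queue I T) (placementOf-∈ I ij ≤-refl)))))
  (cong (requestOf I) (proj₂ (entry-∈ (requestOf I j)
    (subst (requestOf I j ∈_) (sym (map-req-run _)) (∈-queue⁺ I ij ≤-refl)))))
  where T = suc (ready (requestOf I j))

placementOf-bounds : ∀ I {j} → IsJob I j →
  ready (requestOf I j) ≤ begins (placementOf I j) × begins (placementOf I j) ≤ latest (requestOf I j)
placementOf-bounds I {j} ij =
  subst (λ q → ready q ≤ begins (placementOf I j) × begins (placementOf I j) ≤ latest q)
    (req-placementOf I ij) (placement-bounds (queue I _) (placementOf-∈ I ij ≤-refl))

algorithm-competitive : Competitive 16 algorithm
algorithm-competitive I agreeable m ((σ , feasible) , _) = meets , disjoint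
  where
  open Analysis I agreeable feasible

  meets : ∀ j → IsJob I j →
    r j ≤ start (algorithm I) j × start (algorithm I) j + p I j ≤ d I j × machine (algorithm I) j < 16 * m
  meets j ij =
    ≤-trans (rel≤ready (requestOf I j)) (proj₁ (placementOf-bounds I ij)) ,
    ≤-trans (+-monoˡ-≤ (p I j) (proj₂ (placementOf-bounds I ij))) (latest-meets-deadline {requestOf I j} (ij , refl)) ,
    (begin-strict
      machineNumber (line (placementOf I j)) <⟨ machineNumber-< _ (slot (placementOf I j)) ⟩
      2 * suc (slot (placementOf I j))       ≤⟨ *-monoʳ-≤ 2 (slots-bounded (queue I T)
                                                  (proj₁ ∘ ∈-queue⁻ I T) (queue-unique I T) (queue-ordered I T)
                                                  (placementOf-∈ I ij ≤-refl)) ⟩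
      2 * (8 * m)                            ≡⟨ *-assoc 2 8 m ⟨
      16 * m                                 ∎)
    where T = suc (ready (requestOf I j))

  disjoint : ∀ j k → IsJob I j → IsJob I k → j ≢ k → machine (algorithm I) j ≡ machine (algorithm I) k →
    (start (algorithm I) j + p I j ≤ start (algorithm I) k) ⊎ (start (algorithm I) k + p I k ≤ start (algorithm I) j)
  disjoint j k ij ik j≢k same-machine =
    subst₂ (λ x y → begins (placementOf I j) + x ≤ begins (placementOf I k)
                  ⊎ begins (placementOf I k) + y ≤ begins (placementOf I j))
      (cong proc (req-placementOf I ij)) (cong proc (req-placementOf I ik)) separated
    where
    -- A common horizon: both placements occur in this single run, where `run-disjoint` compares
    -- them.
    T = suc (ready (requestOf I j) ⊔ ready (requestOf I k))
    same-line : line (placementOf I j) ≡ line (placementOf I k)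
    same-line = machineNumber-injective same-machine
    separated : ends (placementOf I j) ≤ begins (placementOf I k) ⊎ ends (placementOf I k) ≤ begins (placementOf I j)
    separated with AllPairs-compare (run-disjoint (queue I T))
      (placementOf-∈ I ij (s≤s (m≤m⊔n _ _))) (placementOf-∈ I ik (s≤s (m≤n⊔m (ready (requestOf I j)) _)))
    ... | inj₁ eq = contradiction (trans (cong ident (sym (req-placementOf I ij)))
                      (trans (cong (ident ∘ req) eq) (cong ident (req-placementOf I ik)))) j≢k
    ... | inj₂ (inj₁ k-first) = inj₂ (k-first same-line)
    ... | inj₂ (inj₂ j-first) = inj₁ (j-first (sym same-line))

-- Dependence on released jobs only.

released-cong : ∀ I I′ T → (∀ s → s < T → batch I s ≡ batch I′ s) → released I T ≡ released I′ T
released-cong I I′ zero    same = refl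
released-cong I I′ (suc T) same = cong₂ _++_
  (cong (λ b → map (λ k → request (T , k) (at b k)) (upTo (length b))) (same T ≤-refl))
  (released-cong I I′ T (λ s s<T → same s (m≤n⇒m≤1+n s<T)))

queue-cong : ∀ I I′ T → (∀ s → s < T → batch I s ≡ batch I′ s) → queue I T ≡ queue I′ T
queue-cong I I′ zero    same = refl
queue-cong I I′ (suc T) same = cong₂ _++_
  (cong (λ qs → sort (filter (λ q → ready q ≟ T) qs)) (released-cong I I′ (suc T) same))
  (queue-cong I I′ T (λ s s<T → same s (m≤n⇒m≤1+n s<T)))

-- A start by time `t` in either schedule puts the ready time at or before `t`, and the placement
-- reads no batch after the ready time.
algorithm-online : Online algorithm
algorithm-online I I′ _ _ t same (t₀ , k) ij r≤t started =
  cong begins same-placement , cong (machineNumber ∘ line) same-placement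
  where
  j = t₀ , k
  same-request : requestOf I j ≡ requestOf I′ j
  same-request = cong (λ b → request j (at b k)) (same t₀ r≤t)
  ij′ : IsJob I′ j
  ij′ = subst (λ b → k < length b) (same t₀ r≤t) ij
  ready≤t : (start (algorithm I) j ≤ t ⊎ start (algorithm I′) j ≤ t) → ready (requestOf I j) ≤ t
  ready≤t (inj₁ ≤t) = ≤-trans (proj₁ (placementOf-bounds I ij)) ≤t
  ready≤t (inj₂ ≤t) = subst (λ q → ready q ≤ t) (sym same-request) (≤-trans (proj₁ (placementOf-bounds I′ ij′)) ≤t)
  same-placement : placementOf I j ≡ placementOf I′ j
  same-placement = trans
    (cong (λ qs → entry (requestOf I j) (run qs)) (queue-cong I I′ (suc (ready (requestOf I j)))
      (λ s s<T → same s (≤-trans (s≤s⁻¹ s<T) (ready≤t started)))))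
    (cong (λ q → entry q (run (queue I′ (suc (ready q))))) same-request)

theorem7 : Σ Algorithm (λ A → Online A × Competitive 16 A)
theorem7 = algorithm , algorithm-online , algorithm-competitive
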